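{- For every connected graph $\hat G$ on $n$ vertices with maximum degree $\Delta$ and treewidth $\mathrm{tw}$, $$\mathrm{OPT}(\hat G)=O\big(\Delta(\Delta+\mathrm{tw}\log n)\,n\log n\big).$$
   Context: Let $\hat G=(V,\hat E)$ be a connected unweighted graph with shortest-path metric $\hat\delta$. Let $\widehat{\mathit{NE}}$ be the set of unordered pairs $\{a,b\}$ of distinct vertices with $\{a,b\}\notin\hat E$. For $(u,v)\in V^2$, let $S_{u,v}$ be the set of $\{a,b\}\in\widehat{\mathit{NE}}$ such that $\hat\delta(u,a)+\hat\delta(b,v)+1<\hat\delta(u,v)$ or $\hat\delta(u,b)+\hat\delta(a,v)+1<\hat\delta(u,v)$. Define $\mathrm{OPT}(\hat G)$ as the minimum cardinality of a set $T\subseteq V\times V$ such that $\bigcup_{(u,v)\in T}S_{u,v}=\widehat{\mathit{NE}}$. Treewidth is defined via tree decompositions: the width of a decomposition is the maximum bag size minus one. -}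

module Defs where

open import Data.Fin.Base using (Fin; zero; suc; inject₁; fromℕ; combine)
open import Data.Fin.Properties using (_≟_; any?; all?)
open import Data.Fin.Subset using (Subset; _∈_; ∣_∣; ⊤)
open import Data.Fin.Subset.Properties using (_∈?_; ∈⊤; anySubset?)
open import Data.List.Base using (tabulate)
open import Data.List.Extrema.Nat using (max)
open import Data.Nat.Base using (ℕ; zero; suc; _+_; _*_; _∸_; _≤_; _<_; z≤n; s≤s; NonZero)
open import Data.Nat.Properties as ℕ using (_<?_)
open import Data.Product.Base using (∃; ∃₂; _×_; _,_; proj₁; proj₂)
open import Data.Sum.Base using (_⊎_; inj₁)
open import Data.Vec.Base as Vec using ()
open import Function.Base using (_∘_)
open import Function.Bundles using (_⇔_; mk⇔; Equivalence)
open import Function.Definitions using (Injective)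
open import Level using (Level; 0ℓ)
open import Relation.Binary.Core using (Rel)
open import Relation.Binary.Definitions as B using (Symmetric; Irreflexive)
open import Relation.Binary.PropositionalEquality using (_≡_; _≢_; refl)
open import Relation.Nullary using (¬_; Dec; yes; no; does; contradiction; ¬?; _×-dec_; _⊎-dec_; _→-dec_)
open import Relation.Nullary.Decidable using (map′)
open import Relation.Unary using (Pred; Decidable)

IsLeast : {ℓ : Level} → Pred ℕ ℓ → Pred ℕ ℓ
IsLeast P k = P k × (∀ j → P j → k ≤ j)

least : {ℓ : Level} {P : Pred ℕ ℓ} → Decidable P → ∀ m → P m → ∃ (IsLeast P)
least P? zero p = zero , p , λ _ _ → z≤n
least {P = P} P? (suc m) p with P? zero
... | yes p₀ = zero , p₀ , λ _ _ → z≤n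
... | no ¬p₀ with least {P = P ∘ suc} (P? ∘ suc) m p
...   | k , pk , k≤ = suc k , pk , λ where
          zero    p₀ → contradiction p₀ ¬p₀
          (suc j) pj → s≤s (k≤ j pj)

maximum : {m : ℕ} → (Fin m → ℕ) → ℕ
maximum f = max 0 (tabulate f)

record Graph (n : ℕ) : Set₁ where
  infix 4 _~_ _~?_
  field
    _~_   : Rel (Fin n) 0ℓ
    _~?_  : B.Decidable _~_
    ~-sym : Symmetric _~_
    ~-irr : Irreflexive _≡_ _~_

-- The index is the number of steps.
data Walk {n : ℕ} (R : Rel (Fin n) 0ℓ) : ℕ → Rel (Fin n) 0ℓ where
  []  : ∀ {u} → Walk R 0 u u
  _∷_ : ∀ {k u v w} → R u v → Walk R k v w → Walk R (suc k) u w

walk? : {n : ℕ} {R : Rel (Fin n) 0ℓ} → B.Decidable R → ∀ u v k → Dec (Walk R k u v)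
walk? R? u v zero = map′ (λ { refl → [] }) (λ { [] → refl }) (u ≟ v)
walk? R? u v (suc k) =
  map′ (λ { (_ , r , p) → r ∷ p }) (λ { (r ∷ p) → _ , r , p })
       (any? λ w → R? u w ×-dec walk? R? w v k)

Connected : {n : ℕ} → Graph n → Set
Connected {n} G = NonZero n × (∀ u v → ∃ λ k → Walk _~_ k u v)
  where open Graph G

degree : {n : ℕ} → Graph n → Fin n → ℕ
degree G v = ∣ Vec.tabulate (λ w → does (v ~? w)) ∣
  where open Graph G

maxDegree : {n : ℕ} → Graph n → ℕ
maxDegree G = maximum (degree G)

record Cycle {n : ℕ} (G : Graph n) : Set where
  open Graph G
  field
    {extra}  : ℕ
    vertex   : Fin (3 + extra) → Fin n
    distinct : Injective _≡_ _≡_ vertex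
    step     : ∀ i → vertex (inject₁ i) ~ vertex (suc i)
    close    : vertex (fromℕ (2 + extra)) ~ vertex zero

IsTree : {n : ℕ} → Graph n → Set
IsTree G = Connected G × ¬ Cycle G

record TreeDecomposition {n : ℕ} (G : Graph n) : Set₁ where
  open Graph G
  field
    {nodes} : ℕ
    tree    : Graph nodes
    isTree  : IsTree tree
    bag     : Fin nodes → Subset n

  -- The subgraph of the tree induced by the nodes whose bag contains v.
  TreeEdgeAt : Fin n → Rel (Fin nodes) 0ℓ
  TreeEdgeAt v s t = Graph._~_ tree s t × v ∈ bag s × v ∈ bag t

  field
    coversVertices : ∀ v → ∃ λ t → v ∈ bag t
    coversEdges    : ∀ {u v} → u ~ v → ∃ λ t → u ∈ bag t × v ∈ bag t
    coherent       : ∀ v {s t} → v ∈ bag s → v ∈ bag t →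
                     ∃ λ k → Walk (TreeEdgeAt v) k s t

  width : ℕ
  width = maximum (λ t → ∣ bag t ∣) ∸ 1

-- A relation rather than a function, since there are infinitely many tree
-- decompositions to minimise over.
IsTreewidth : {n : ℕ} → Graph n → ℕ → Set₁
IsTreewidth G = IsLeast (λ w → ∃ λ (D : TreeDecomposition G) → TreeDecomposition.width D ≡ w)

module _ {n : ℕ} (G : Graph n) (connected : Connected G) where
  open Graph G

  shortestWalk : ∀ u v → ∃ (IsLeast (λ k → Walk _~_ k u v))
  shortestWalk u v = let k , p = connected .proj₂ u v in least (walk? _~?_ u v) k p

  δ : Fin n → Fin n → ℕ
  δ u v = proj₁ (shortestWalk u v)

  -- An unordered pair {a , b} is represented by both (a , b) and (b , a);
  -- NonEdge and S u v are symmetric in a and b.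
  NonEdge : Rel (Fin n) 0ℓ
  NonEdge a b = a ≢ b × ¬ (a ~ b)

  S : Fin n → Fin n → Rel (Fin n) 0ℓ
  S u v a b = NonEdge a b ×
    (δ u a + δ b v + 1 < δ u v ⊎ δ u b + δ a v + 1 < δ u v)

  -- combine identifies V × V with Fin (n * n).
  Covers : Subset (n * n) → Set
  Covers T = ∀ a b → (∃₂ λ u v → combine u v ∈ T × S u v a b) ⇔ NonEdge a b

  CoverOfSize : ℕ → Set
  CoverOfSize k = ∃ λ T → Covers T × ∣ T ∣ ≡ k

  nonEdge? : B.Decidable NonEdge
  nonEdge? a b = ¬? (a ≟ b) ×-dec ¬? (a ~? b)

  S? : ∀ u v → B.Decidable (S u v)
  S? u v a b = nonEdge? a b ×-dec
    ((δ u a + δ b v + 1 <? δ u v) ⊎-dec (δ u b + δ a v + 1 <? δ u v))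

  covers? : Decidable Covers
  covers? T = all? λ a → all? λ b →
    let covered? = any? λ u → any? λ v → (combine u v ∈? T) ×-dec S? u v a b
    in map′ (λ (f , g) → mk⇔ f g) (λ e → Equivalence.to e , Equivalence.from e)
            ((covered? →-dec nonEdge? a b) ×-dec (nonEdge? a b →-dec covered?))

  coverOfSize? : Decidable CoverOfSize
  coverOfSize? k = anySubset? λ T → covers? T ×-dec (∣ T ∣ ℕ.≟ k)

  δ-refl : ∀ u → δ u u ≡ 0
  δ-refl u = ℕ.n≤0⇒n≡0 (proj₂ (proj₂ (shortestWalk u u)) 0 [])

  nonEdge⇒1<δ : ∀ {a b} → NonEdge a b → 1 < δ a b
  nonEdge⇒1<δ {a} {b} (a≢b , a≁b) with shortestWalk a b
  ... | 0           , []     , _ = contradiction refl a≢b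
  ... | 1           , r ∷ [] , _ = contradiction r a≁b
  ... | suc (suc _) , _      , _ = s≤s (s≤s z≤n)

  nonEdge⇒S : ∀ {a b} → NonEdge a b → S a b a b
  nonEdge⇒S {a} {b} ab rewrite δ-refl a | δ-refl b = ab , inj₁ (nonEdge⇒1<δ ab)

  ⊤-covers : Covers ⊤
  ⊤-covers a b = mk⇔ (λ (_ , _ , _ , ab , _) → ab) (λ ab → a , b , ∈⊤ , nonEdge⇒S ab)

  minimumCover : ∃ (IsLeast CoverOfSize)
  minimumCover = least coverOfSize? ∣ ⊤ {n * n} ∣ (⊤ , ⊤-covers , refl)

  OPT : ℕ
  OPT = proj₁ minimumCover

{-# OPTIONS --safe #-}

-- Centroid decomposition. For a vertex set U, choose a bag X whose node is a centroid of the tree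
-- with respect to U, and query N[X] × U; recurse into the part of U in each branch of the tree at
-- that node. If a, b ∈ U lie in different branches, a shortest walk from a to b meets some x ∈ X.
-- Say x is no farther from a than from b: then either x = a or the neighbour u of x towards a
-- satisfies δ u a + 1 < δ u b, so the query (u , b) detects the non-edge {a , b}.
-- All distances are taken in the whole graph, so the parts need not preserve distances. There are
-- at most ⌊log₂ n⌋ + 1 levels, each with at most (tw + 1)(Δ + 1) n queries.
module Submission where

open import Defs
open import Data.Nat using (ℕ; _+_; _*_; _≤_)
open import Data.Nat.Logarithm using (⌊log₂_⌋)
open import Data.Product using (∃-syntax)

open import Data.Empty using (⊥-elim)
open import Data.Fin.Base using (Fin; zero; suc; toℕ; fromℕ; inject₁; combine)
open import Data.Fin.Properties using (_≟_; any?; all?; pigeonhole; toℕ-inject₁; toℕ-fromℕ; toℕ<n; <-cmp; ¬∀⟶∃¬)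
open import Data.Fin.Subset using (Subset; ∣_∣; _∪_; ⊥; ⁅_⁆; inside; outside) renaming (_∈_ to _∈ₛ_; _∉_ to _∉ₛ_)
open import Data.Fin.Subset.Properties using (_∈?_; ∣⊥∣≡0; ∣⁅x⁆∣≡1; x∈⁅x⁆; p⊆p∪q; q⊆p∪q)
open import Data.List.Base using (List; []; _∷_; _++_; length; map; filter; concatMap; allFin; tabulate)
open import Data.List.Extrema.Nat using (xs≤max)
open import Data.List.Membership.Propositional using (_∈_; lose)
open import Data.List.Membership.Propositional.Properties
  using (∈-allFin; ∈-filter⁺; ∈-concatMap⁺; ∈-map⁺; ∈-++⁺ˡ; ∈-++⁺ʳ)
open import Data.List.Properties using (length-map; length-++; length-tabulate)
open import Data.List.Relation.Binary.Sublist.Propositional.Properties using (filter⁺; filter-⊆; length-mono-≤)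
open import Data.List.Relation.Unary.All.Properties using (tabulate⁻)
open import Data.List.Relation.Unary.Any using (here; there)
open import Data.Nat.Base using (NonZero; zero; suc; _∸_; _^_; _<_; _≰_; z≤n; s≤s; z<s)
open import Data.Nat.Induction using (Acc; acc; <-wellFounded)
open import Data.Nat.Logarithm using (⌊log₂⌋-mono-≤; ⌊log₂[2^n]⌋≡n)
open import Data.Nat.Properties hiding (_≟_; <-cmp)
open import Data.Nat.Tactic.RingSolver using (solve-∀)
open import Data.Product.Base using (∃; ∃₂; _×_; _,_; proj₁; proj₂)
open import Data.Sum.Base as Sum using (_⊎_; inj₁; inj₂)
import Data.Vec.Base as Vec
import Data.Vec.Properties as Vec
open import Data.Unit.Base using (⊤; tt)
open import Function.Base using (_∘_; id; const; case_of_)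
open import Function.Bundles using (mk⇔)
open import Level using (0ℓ)
open import Relation.Binary.Construct.Closure.ReflexiveTransitive as Star using (Star; ε; _◅_; _◅◅_)
open import Relation.Binary.Core using (Rel)
open import Relation.Binary.Definitions using (tri<; tri≈; tri>)
open import Relation.Binary.PropositionalEquality
open import Relation.Nullary using (¬_; yes; no; does; contradiction; ¬?; _×-dec_; _→-dec_)
open import Relation.Nullary.Decidable using (dec-true)
open import Relation.Unary using (Pred; Decidable)

-- Counting in lists and finite subsets.

module _ {A : Set} {P : Pred A 0ℓ} (P? : Decidable P) where

  length-filter-∁ : ∀ xs → length (filter P? xs) + length (filter (¬? ∘ P?) xs) ≡ length xs
  length-filter-∁ [] = refl
  length-filter-∁ (x ∷ xs) with P? x
  ... | yes _ = cong suc (length-filter-∁ xs)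
  ... | no  _ = trans (+-suc _ _) (cong suc (length-filter-∁ xs))

  common-member : {Q : Pred A 0ℓ} (Q? : Decidable Q) → ∀ xs →
    length xs < length (filter P? xs) + length (filter Q? xs) → ∃ λ x → P x × Q x
  common-member Q? (x ∷ xs) lt with P? x | Q? x
  ... | yes p | yes q = x , p , q
  ... | yes _ | no  _ = common-member Q? xs (≤-pred lt)
  ... | no  _ | yes _ = common-member Q? xs (≤-pred (≤-trans lt (≤-reflexive (+-suc _ _))))
  ... | no  _ | no  _ = common-member Q? xs (<⇒≤ lt)

length-concatMap-≤ : {A B : Set} (f : A → List B) {k : ℕ} →
  (∀ x → length (f x) ≤ k) → ∀ xs → length (concatMap f xs) ≤ length xs * k
length-concatMap-≤ f h [] = z≤n
length-concatMap-≤ f h (x ∷ xs) =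
  ≤-trans (≤-reflexive (length-++ (f x))) (+-mono-≤ (h x) (length-concatMap-≤ f h xs))

elements : ∀ {n} → Subset n → List (Fin n)
elements Vec.[]              = []
elements (outside Vec.∷ p) = map suc (elements p)
elements (inside  Vec.∷ p) = zero ∷ map suc (elements p)

length-elements : ∀ {n} (p : Subset n) → length (elements p) ≡ ∣ p ∣
length-elements Vec.[]              = refl
length-elements (outside Vec.∷ p) = trans (length-map suc (elements p)) (length-elements p)
length-elements (inside  Vec.∷ p) = cong suc (trans (length-map suc (elements p)) (length-elements p))

∈-elements : ∀ {n} {x : Fin n} {p : Subset n} → x ∈ₛ p → x ∈ elements p
∈-elements {p = _}                 Vec.here        = here refl
∈-elements {p = outside Vec.∷ _} (Vec.there x∈p) = ∈-map⁺ suc (∈-elements x∈p)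
∈-elements {p = inside  Vec.∷ _} (Vec.there x∈p) = there (∈-map⁺ suc (∈-elements x∈p))

∣p∪q∣≤∣p∣+∣q∣ : ∀ {n} (p q : Subset n) → ∣ p ∪ q ∣ ≤ ∣ p ∣ + ∣ q ∣
∣p∪q∣≤∣p∣+∣q∣ Vec.[] Vec.[] = z≤n
∣p∪q∣≤∣p∣+∣q∣ (outside Vec.∷ p) (outside Vec.∷ q) = ∣p∪q∣≤∣p∣+∣q∣ p q
∣p∪q∣≤∣p∣+∣q∣ (outside Vec.∷ p) (inside  Vec.∷ q) =
  ≤-trans (s≤s (∣p∪q∣≤∣p∣+∣q∣ p q)) (≤-reflexive (sym (+-suc _ _)))
∣p∪q∣≤∣p∣+∣q∣ (inside  Vec.∷ p) (outside Vec.∷ q) = s≤s (∣p∪q∣≤∣p∣+∣q∣ p q)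
∣p∪q∣≤∣p∣+∣q∣ (inside  Vec.∷ p) (inside  Vec.∷ q) =
  s≤s (≤-trans (∣p∪q∣≤∣p∣+∣q∣ p q) (+-monoʳ-≤ ∣ p ∣ (n≤1+n _)))

fromList : ∀ {n} → List (Fin n) → Subset n
fromList []       = ⊥
fromList (x ∷ xs) = ⁅ x ⁆ ∪ fromList xs

∣fromList∣≤length : ∀ {n} (xs : List (Fin n)) → ∣ fromList xs ∣ ≤ length xs
∣fromList∣≤length {n} [] = ≤-reflexive (∣⊥∣≡0 n)
∣fromList∣≤length (x ∷ xs) = ≤-trans (∣p∪q∣≤∣p∣+∣q∣ ⁅ x ⁆ (fromList xs))
  (+-mono-≤ (≤-reflexive (∣⁅x⁆∣≡1 x)) (∣fromList∣≤length xs))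

∈-fromList : ∀ {n} {x : Fin n} {xs} → x ∈ xs → x ∈ₛ fromList xs
∈-fromList {x = x} (here refl)           = p⊆p∪q _ (x∈⁅x⁆ x)
∈-fromList {xs = y ∷ xs} (there x∈xs) = q⊆p∪q ⁅ y ⁆ (fromList xs) (∈-fromList x∈xs)

≤-maximum : ∀ {m} (f : Fin m → ℕ) i → f i ≤ maximum f
≤-maximum f = tabulate⁻ (xs≤max 0 (tabulate f))

n<2^[1+⌊log₂n⌋] : ∀ n → n < 2 ^ suc ⌊log₂ n ⌋
n<2^[1+⌊log₂n⌋] n = ≰⇒> λ 2^≤n → 1+n≰n
  (subst (_≤ ⌊log₂ n ⌋) (⌊log₂[2^n]⌋≡n (suc ⌊log₂ n ⌋)) (⌊log₂⌋-mono-≤ 2^≤n))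

-- Trees

module _ {m : ℕ} where

  -- `f` is total on `ℕ` although only `f 0` to `f k` are constrained: subwalks are then shifts of
  -- `f`, and an infinite ray is one `f` that satisfies this for every `k`.
  NonBacktracking : Rel (Fin m) 0ℓ → ℕ → (ℕ → Fin m) → Set
  NonBacktracking R k f = (∀ {i} → i < k → R (f i) (f (suc i)))
                        × (∀ {i} → suc i < k → f i ≢ f (suc (suc i)))

  segment : ∀ {R k f} → NonBacktracking R k f → ∀ i l → l + i ≤ k →
    NonBacktracking R l (λ x → f (x + i))
  segment (step , nb) i l l+i≤k =
    (λ x<l → step (≤-trans (+-monoˡ-< i x<l) l+i≤k)) ,
    (λ x<l → nb (≤-trans (+-monoˡ-< i x<l) l+i≤k))

  prepend : Fin m → (ℕ → Fin m) → ℕ → Fin m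
  prepend a f zero    = a
  prepend a f (suc i) = f i

  prepend-nb : ∀ {R k f a} → R a (f 0) → (0 < k → a ≢ f 1) →
    NonBacktracking R k f → NonBacktracking R (suc k) (prepend a f)
  prepend-nb {R} {k} {f} {a} r a≢f1 (step , nb) = step′ , nb′
    where
    step′ : ∀ {i} → i < suc k → R (prepend a f i) (f i)
    step′ {zero}  _         = r
    step′ {suc i} (s≤s i<k) = step i<k

    nb′ : ∀ {i} → suc i < suc k → prepend a f i ≢ f (suc i)
    nb′ {zero}  (s≤s 0<k) = a≢f1 0<k
    nb′ {suc i} (s≤s i<k) = nb i<k

  -- Prepending a step to a reduced walk can create a backtrack only at the front; then that step
  -- and the first step of the walk cancel.
  reduce : ∀ {R a b} → Star R a b →
    ∃₂ λ k f → f 0 ≡ a × f k ≡ b × NonBacktracking R k f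
  reduce {a = a} ε = 0 , const a , refl , refl , (λ ()) , (λ ())
  reduce {R} {a} (r ◅ p) with reduce p
  ... | zero , f , refl , fk , f-nb =
    1 , prepend a f , refl , fk , prepend-nb {R} r (λ ()) f-nb
  ... | suc k , f , refl , fk , f-nb@(step , nb) with a ≟ f 1
  ...   | yes a≡f1 = k , f ∘ suc , sym a≡f1 , fk , step ∘ s≤s , nb ∘ s≤s
  ...   | no  a≢f1 = suc (suc k) , prepend a f , refl , fk , prepend-nb {R} r (λ _ → a≢f1) f-nb

module _ {m : ℕ} (T : Graph m) where
  open Graph T

  -- A repeated vertex cuts out a shorter closed walk; without repeats the walk itself is a cycle.
  -- Lengths 1 and 2 would be a loop or a backtrack.
  closed⇒Cycle : ∀ {k} → Acc _<_ k → 0 < k → ∀ f → NonBacktracking _~_ k f → f 0 ≡ f k → Cycle T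
  closed⇒Cycle {1} _ _ f (step , _) eq = contradiction (step z<s) (~-irr eq)
  closed⇒Cycle {2} _ _ f (_ , nb)   eq = contradiction eq (nb (s≤s (s≤s z≤n)))
  closed⇒Cycle {suc (suc (suc e))} (acc rs) _ f f-nb@(step , _) eq
    -- The indices stop before the last one, so the coincidence of the two ends is no repeat and
    -- every closed segment found is strictly shorter.
    with any? {n = 3 + e} (λ i → any? {n = 3 + e} λ j → (toℕ i <? toℕ j) ×-dec (f (toℕ i) ≟ f (toℕ j)))
  ... | yes (i , j , i<j , fi≡fj) =
    closed⇒Cycle (rs (≤-<-trans (m∸n≤m (toℕ j) (toℕ i)) (toℕ<n j))) (m<n⇒0<n∸m i<j)
      (λ x → f (x + toℕ i))
      (segment {R = _~_} f-nb (toℕ i) (toℕ j ∸ toℕ i) (≤-trans (≤-reflexive j≡) (<⇒≤ (toℕ<n j))))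
      (trans fi≡fj (cong f (sym j≡)))
    where j≡ = m∸n+n≡m (<⇒≤ i<j)
  ... | no ¬repeat = record
    { vertex   = f ∘ toℕ
    ; distinct = λ {i} {j} → inj i j
    ; step     = λ i → subst (λ x → f x ~ f (suc (toℕ i))) (sym (toℕ-inject₁ i)) (step (<-trans (toℕ<n i) (n<1+n _)))
    ; close    = subst₂ (λ x y → f x ~ y) (sym (toℕ-fromℕ (2 + e))) (sym eq) (step (n<1+n (2 + e)))
    }
    where
    inj : ∀ (i j : Fin (3 + e)) → f (toℕ i) ≡ f (toℕ j) → i ≡ j
    inj i j fi≡fj with <-cmp i j
    ... | tri< i<j _ _ = contradiction (i , j , i<j , fi≡fj) ¬repeat
    ... | tri≈ _ i≡j _ = i≡j
    ... | tri> _ _ j<i = contradiction (j , i , j<i , sym fi≡fj) ¬repeat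

  -- By pigeonhole two of the first `m + 1` terms agree, and the stretch between them is closed.
  ray⇒Cycle : ∀ f → (∀ k → NonBacktracking _~_ k f) → Cycle T
  ray⇒Cycle f f-nb =
    let i , j , i<j , fi≡fj = pigeonhole (n<1+n m) (f ∘ toℕ)
        j≡ = m∸n+n≡m (<⇒≤ i<j)
    in closed⇒Cycle (<-wellFounded _) (m<n⇒0<n∸m i<j) (λ x → f (x + toℕ i))
         (segment {R = _~_} (f-nb (toℕ j)) (toℕ i) (toℕ j ∸ toℕ i) (≤-reflexive j≡))
         (trans fi≡fj (cong f (sym j≡)))

  -- For endpoints other than `t`, `Star (Avoid t)` is connectivity in `T` with `t` removed.
  Avoid : Fin m → Rel (Fin m) 0ℓ
  Avoid t a b = a ~ b × a ≢ t × b ≢ t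

  avoid-sym : ∀ {t a b} → Avoid t a b → Avoid t b a
  avoid-sym (r , a≢t , b≢t) = ~-sym r , b≢t , a≢t

  -- Only the orientation from `c` to `t` is removed. Walks avoiding `t` and walks avoiding `c` both
  -- qualify, so they can be concatenated.
  OtherThan : Fin m → Fin m → Rel (Fin m) 0ℓ
  OtherThan c t a b = a ~ b × ¬ (a ≡ c × b ≡ t)

  avoid-target : ∀ {c t a b} → Avoid t a b → OtherThan c t a b
  avoid-target (r , _ , b≢t) = r , b≢t ∘ proj₂

  avoid-source : ∀ {c t a b} → Avoid c a b → OtherThan c t a b
  avoid-source (r , a≢c , _) = r , a≢c ∘ proj₁

  exit : ∀ {t k s} → Walk _~_ k s t → s ≢ t → ∃ λ c → c ~ t × Star (Avoid t) s c
  exit [] s≢t = contradiction refl s≢t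
  exit {t} {s = s} (_∷_ {v = w} r p) s≢t with w ≟ t
  ... | yes refl = s , r , ε
  ... | no  w≢t  = let c , c~t , q = exit p w≢t in c , c~t , (r , s≢t , w≢t) ◅ q

module Tree {m : ℕ} (T : Graph m) (isTree : IsTree T) where
  open Graph T

  -- Putting `t` before the reduced walk closes it. The new front does not backtrack, since the
  -- first step out of `c` cannot go to `t`, so a cycle results.
  bridge : ∀ {c t} → c ~ t → ¬ Star (OtherThan T c t) c t
  bridge {c} {t} c~t p with reduce p
  ... | zero  , f , refl , fk , _ = ~-irr fk c~t
  ... | suc k , f , refl , fk , step , nb = isTree .proj₂
    (closed⇒Cycle T (<-wellFounded (suc (suc k))) z<s (prepend t f)
      (prepend-nb {R = _~_} (~-sym c~t) (λ _ t≡f1 → step z<s .proj₂ (refl , sym t≡f1)) (proj₁ ∘ step , nb))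
      (sym fk))

  -- `c` is the neighbour of `t` at which the branch containing `s` hangs. The default `t` for
  -- `s ≡ t` reserves the label `t` for the node itself.
  direction : ∀ t s → ∃ λ c → (s ≢ t → c ~ t × Star (Avoid T t) s c) × (s ≡ t → c ≡ t)
  direction t s with s ≟ t
  ... | yes s≡t = t , (λ s≢t → contradiction s≡t s≢t) , λ _ → refl
  ... | no  s≢t = let c , c~t , p = exit T (isTree .proj₁ .proj₂ s t .proj₂) s≢t
                  in c , (λ _ → c~t , p) , λ s≡t → contradiction s≡t s≢t

  dir : Fin m → Fin m → Fin m
  dir t s = direction t s .proj₁

  dir~ : ∀ {t s} → s ≢ t → dir t s ~ t
  dir~ {t} {s} s≢t = direction t s .proj₂ .proj₁ s≢t .proj₁

  dir-path : ∀ {t s} → s ≢ t → Star (Avoid T t) s (dir t s)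
  dir-path {t} {s} s≢t = direction t s .proj₂ .proj₁ s≢t .proj₂

  dir≢⇒≢ : ∀ {t s} → dir t s ≢ t → s ≢ t
  dir≢⇒≢ {t} {s} d≢t = d≢t ∘ direction t s .proj₂ .proj₂

  -- With two different directions, going from one through `s` and `s′` to the other and then into
  -- `t` would bypass the edge from `dir t s` to `t`.
  dir-cong : ∀ {t s s′} → s ≢ t → s′ ≢ t → Star (Avoid T t) s s′ → dir t s ≡ dir t s′
  dir-cong {t} {s} {s′} s≢t s′≢t p with dir t s ≟ dir t s′
  ... | yes eq = eq
  ... | no  ne = ⊥-elim (bridge (dir~ s≢t)
    (Star.map (avoid-target T) (Star.reverse (avoid-sym T) (dir-path s≢t) ◅◅ p ◅◅ dir-path s′≢t)
      ◅◅ (dir~ s′≢t , ne ∘ sym ∘ proj₁) ◅ ε))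

  -- Going from `c` to `s` off `t` and on from `s` to `t` off `c` would bypass the edge between `c`
  -- and `t`. So the two branches facing each other across an edge are disjoint.
  dir-opposite : ∀ {t c s} → c ≢ t → dir t s ≡ c → dir c s ≢ t
  dir-opposite {s = s} c≢t refl eq = bridge (dir~ s≢t)
    (Star.map (avoid-target T) (Star.reverse (avoid-sym T) (dir-path s≢t))
      ◅◅ subst (Star _ s) eq (Star.map (avoid-source T) (dir-path (dir≢⇒≢ λ e → c≢t (trans (sym e) eq)))))
    where s≢t = dir≢⇒≢ c≢t

  module _ {A : Set} (h : A → Fin m) (U : List A) where

    branch : Fin m → Fin m → List A
    branch t c = filter (λ w → dir t (h w) ≟ c) U

    Balanced : Fin m → Set
    Balanced t = ∀ c → c ≢ t → 2 * length (branch t c) ≤ length U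

    -- If the two sizes summed to at most `length U`, the smaller would be at most half of it.
    heavy-overlap : ∀ {t c t′ c′} → 2 * length (branch t c) ≰ length U → 2 * length (branch t′ c′) ≰ length U →
      ∃ λ w → dir t (h w) ≡ c × dir t′ (h w) ≡ c′
    heavy-overlap {t} {c} {t′} {c′} p q = common-member _ _ U (≰⇒> (sum≰ (≤-total x y)))
      where
      x = length (branch t c)
      y = length (branch t′ c′)
      sum≰ : x ≤ y ⊎ y ≤ x → x + y ≰ length U
      sum≰ (inj₁ x≤y) le = p (≤-trans (+-monoʳ-≤ x (≤-trans (≤-reflexive (+-identityʳ x)) x≤y)) le)
      sum≰ (inj₂ y≤x) le = q (≤-trans (+-mono-≤ y≤x (≤-reflexive (+-identityʳ y))) le)

    -- If no node were balanced, always stepping into the heavy branch would never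
    -- turn back, since opposite branches along an edge are disjoint.
    centroid : ∃ Balanced
    centroid with any? (λ t → all? λ c → ¬? (c ≟ t) →-dec (2 * length (branch t c) ≤? length U))
    ... | yes balanced = balanced
    ... | no ¬balanced = ⊥-elim (isTree .proj₂ (ray⇒Cycle T ray λ k → (λ {i} _ → ray-step i) , λ {i} _ → ray-nb i))
      where
      heavy : ∀ t → ∃ λ c → c ≢ t × 2 * length (branch t c) ≰ length U
      heavy t =
        let c , ¬c = ¬∀⟶∃¬ m _ (λ c → ¬? (c ≟ t) →-dec (2 * length (branch t c) ≤? length U))
                       (λ bal → ¬balanced (t , bal))
        in c , (λ c≡t → ¬c λ c≢t → contradiction c≡t c≢t) , λ le → ¬c λ _ → le

      next : Fin m → Fin m
      next t = heavy t .proj₁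

      next≢ : ∀ t → next t ≢ t
      next≢ t = heavy t .proj₂ .proj₁

      next-heavy : ∀ t → 2 * length (branch t (next t)) ≰ length U
      next-heavy t = heavy t .proj₂ .proj₂

      next~ : ∀ t → t ~ next t
      next~ t =
        -- An element of the heavy branch, found by overlapping it with itself, shows that the label
        -- `next t` is a neighbour of `t`.
        let w , eq , _ = heavy-overlap (next-heavy t) (next-heavy t)
        in ~-sym (subst (_~ t) eq (dir~ (dir≢⇒≢ {t} {h w} (next≢ t ∘ trans (sym eq)))))

      next-next≢ : ∀ t → next (next t) ≢ t
      next-next≢ t eq =
        let w , e , e′ = heavy-overlap (next-heavy t) (next-heavy (next t))
        in dir-opposite {s = h w} (next≢ t) e (trans e′ eq)

      ray : ℕ → Fin m
      ray zero    = root (isTree .proj₁ .proj₁)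
        where
        root : ∀ {m} → NonZero m → Fin m
        root {suc _} _ = zero
      ray (suc i) = next (ray i)

      ray-step : ∀ i → ray i ~ ray (suc i)
      ray-step i = next~ (ray i)

      ray-nb : ∀ i → ray i ≢ ray (suc (suc i))
      ray-nb i eq = next-next≢ (ray i) (sym eq)

-- Distances

module _ {n : ℕ} (G : Graph n) where
  open Graph G

  _++ʷ_ : ∀ {k l u v w} → Walk _~_ k u v → Walk _~_ l v w → Walk _~_ (k + l) u w
  []      ++ʷ q = q
  (r ∷ p) ++ʷ q = r ∷ (p ++ʷ q)

  reverseʷ : ∀ {k u v} → Walk _~_ k u v → Walk _~_ k v u
  reverseʷ [] = []
  reverseʷ {suc k} {u} {v} (r ∷ p) = subst (λ l → Walk _~_ l v u) (+-comm k 1) (reverseʷ p ++ʷ (~-sym r ∷ []))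

  neighbours : Fin n → List (Fin n)
  neighbours v = elements (Vec.tabulate (λ w → does (v ~? w)))

  ∈-neighbours : ∀ {v w} → v ~ w → w ∈ neighbours v
  ∈-neighbours {v} {w} v~w = ∈-elements {p = Vec.tabulate (λ u → does (v ~? u))}
    (Vec.lookup⇒[]= w _ (trans (Vec.lookup∘tabulate _ w) (dec-true (v ~? w) v~w)))

  closedNbhd : Fin n → List (Fin n)
  closedNbhd v = v ∷ neighbours v

  ∈-closedNbhd : ∀ {v w} → v ≡ w ⊎ v ~ w → w ∈ closedNbhd v
  ∈-closedNbhd (inj₁ refl) = here refl
  ∈-closedNbhd (inj₂ v~w)  = there (∈-neighbours v~w)

  length-closedNbhd : ∀ v → length (closedNbhd v) ≤ suc (maxDegree G)
  length-closedNbhd v =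
    s≤s (≤-trans (≤-reflexive (length-elements (Vec.tabulate (λ w → does (v ~? w))))) (≤-maximum (degree G) v))

  queries : Subset n → List (Fin n) → List (Fin n × Fin n)
  queries X U = concatMap (λ u → map (u ,_) U) (concatMap closedNbhd (elements X))

  length-queries : ∀ X U → length (queries X U) ≤ (∣ X ∣ * suc (maxDegree G)) * length U
  length-queries X U = ≤-trans
    (length-concatMap-≤ _ (λ u → ≤-reflexive (length-map (u ,_) U)) (concatMap closedNbhd (elements X)))
    (*-monoˡ-≤ (length U) (≤-trans (length-concatMap-≤ closedNbhd length-closedNbhd (elements X))
      (≤-reflexive (cong (_* suc (maxDegree G)) (length-elements X)))))

  ∈-queries : ∀ {X U x u v} → x ∈ₛ X → x ≡ u ⊎ x ~ u → v ∈ U → (u , v) ∈ queries X U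
  ∈-queries {X} {u = u} x∈X near v∈U =
    ∈-concatMap⁺ _ (lose (∈-concatMap⁺ closedNbhd (lose (∈-elements x∈X) (∈-closedNbhd near))) (∈-map⁺ (u ,_) v∈U))

module _ {n : ℕ} (G : Graph n) (connected : Connected G) where
  open Graph G

  private
    d : Fin n → Fin n → ℕ
    d = δ G connected

  d-walk : ∀ u v → Walk _~_ (d u v) u v
  d-walk u v = shortestWalk G connected u v .proj₂ .proj₁

  d≤ : ∀ {k u v} → Walk _~_ k u v → d u v ≤ k
  d≤ {k} {u} {v} = shortestWalk G connected u v .proj₂ .proj₂ k

  d-sym : ∀ u v → d u v ≡ d v u
  d-sym u v = ≤-antisym (d≤ (reverseʷ G (d-walk v u))) (d≤ (reverseʷ G (d-walk u v)))

  nonEdge-sym : ∀ {a b} → NonEdge G connected a b → NonEdge G connected b a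
  nonEdge-sym (a≢b , a≁b) = a≢b ∘ sym , a≁b ∘ ~-sym

  S-swap : ∀ {u v a b} → S G connected u v a b → S G connected u v b a
  S-swap (ne , s) = nonEdge-sym ne , Sum.swap s

  -- One step from x towards the nearer endpoint makes the distances to a and b differ by at least 2.
  near-covers : ∀ {i j x a b} → NonEdge G connected a b → Walk _~_ i x a → i + j ≡ d a b → i ≤ j →
    ∃ λ u → (x ≡ u ⊎ x ~ u) × S G connected u b a b
  near-covers {a = a} ne [] _ _ = a , inj₁ refl , nonEdge⇒S G connected ne
  near-covers {suc i} {j} {a = a} {b} ne (_∷_ {v = y} r p) eq i<j = y , inj₂ r , ne , inj₁ far
    where
    open ≤-Reasoning
    j<d : j < d y b
    j<d = +-cancelˡ-≤ i _ _ (begin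
      i + suc j   ≡⟨ +-suc i j ⟩
      suc i + j   ≡⟨ eq ⟩
      d a b       ≤⟨ d≤ (_++ʷ_ G (reverseʷ G p) (d-walk y b)) ⟩
      i + d y b   ∎)
    far : d y a + d b b + 1 < d y b
    far = begin-strict
      d y a + d b b + 1 ≡⟨ cong (λ z → d y a + z + 1) (δ-refl G connected b) ⟩
      d y a + 0 + 1     ≡⟨ trans (cong (_+ 1) (+-identityʳ (d y a))) (+-comm (d y a) 1) ⟩
      suc (d y a)       ≤⟨ s≤s (d≤ p) ⟩
      suc i             ≤⟨ i<j ⟩
      j                 <⟨ j<d ⟩
      d y b             ∎

  -- Covers of vertex lists.

  CoveredBy : List (Fin n × Fin n) → Rel (Fin n) 0ℓ
  CoveredBy L a b = ∃₂ λ u v → (u , v) ∈ L × S G connected u v a b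

  between-covered : ∀ {X U i j x a b} → a ∈ U → b ∈ U → NonEdge G connected a b →
    x ∈ₛ X → Walk _~_ i a x → Walk _~_ j x b → i + j ≡ d a b → CoveredBy (queries G X U) a b
  between-covered {i = i} {j} {a = a} {b} a∈U b∈U ne x∈X p q eq with ≤-total i j
  ... | inj₁ i≤j = let u , near , s = near-covers ne (reverseʷ G p) eq i≤j
                   in u , b , ∈-queries G x∈X near b∈U , s
  ... | inj₂ j≤i = let u , near , s = near-covers (nonEdge-sym ne) q (trans (+-comm j i) (trans eq (d-sym a b))) j≤i
                   in u , a , ∈-queries G x∈X near a∈U , S-swap s

  -- `r` is a budget of pairs per vertex of `U`; a size linear in `length U` survives the joining of
  -- covers of disjoint parts. The relation marks the pairs still to be handled and shrinks as
  -- classes are split off.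
  record Cover (r : ℕ) (U : List (Fin n)) (_∼_ : Rel (Fin n) 0ℓ) : Set where
    field
      pairs  : List (Fin n × Fin n)
      size   : length pairs ≤ r * length U
      covers : ∀ {a b} → a ∈ U → b ∈ U → a ∼ b → NonEdge G connected a b → CoveredBy pairs a b

  coveredBy-++ˡ : ∀ {L M a b} → CoveredBy L a b → CoveredBy (L ++ M) a b
  coveredBy-++ˡ (u , v , uv∈L , s) = u , v , ∈-++⁺ˡ uv∈L , s

  coveredBy-++ʳ : ∀ L {M a b} → CoveredBy M a b → CoveredBy (L ++ M) a b
  coveredBy-++ʳ L (u , v , uv∈M , s) = u , v , ∈-++⁺ʳ L uv∈M , s

  Everything : Rel (Fin n) 0ℓ
  Everything _ _ = ⊤

  cover-split : ∀ {r U P} (P? : Decidable P) {_∼_ _≈_ : Rel (Fin n) 0ℓ} →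
    (∀ {a b} → a ∼ b → (P a × P b) ⊎ (¬ P a × ¬ P b × a ≈ b)) →
    Cover r (filter P? U) Everything → Cover r (filter (¬? ∘ P?) U) _≈_ → Cover r U _∼_
  cover-split {r} {U} P? split C D = record
    { pairs  = C.pairs ++ D.pairs
    ; size   = begin
        length (C.pairs ++ D.pairs)       ≡⟨ length-++ C.pairs ⟩
        length C.pairs + length D.pairs   ≤⟨ +-mono-≤ C.size D.size ⟩
        r * length (filter P? U) + r * length (filter (¬? ∘ P?) U)
          ≡⟨ *-distribˡ-+ r (length (filter P? U)) _ ⟨
        r * (length (filter P? U) + length (filter (¬? ∘ P?) U))
          ≡⟨ cong (r *_) (length-filter-∁ P? U) ⟩
        r * length U ∎
    ; covers = λ a∈U b∈U a∼b ne → case split a∼b of λ where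
        (inj₁ (pa , pb)) →
          coveredBy-++ˡ (C.covers (∈-filter⁺ P? a∈U pa) (∈-filter⁺ P? b∈U pb) tt ne)
        (inj₂ (¬pa , ¬pb , a≈b)) →
          coveredBy-++ʳ C.pairs (D.covers (∈-filter⁺ (¬? ∘ P?) a∈U ¬pa) (∈-filter⁺ (¬? ∘ P?) b∈U ¬pb) a≈b ne)
    }
    where
    module C = Cover C
    module D = Cover D
    open ≤-Reasoning

  module _ {m r bound : ℕ} (solve : ∀ U → length U < bound → Cover r U Everything)
           (ℓ : Fin n → Fin m) (t : Fin m) where

    -- `cs` lists the labels not yet processed, on which `cover-classes` recurses.
    SameClass : List (Fin m) → Rel (Fin n) 0ℓ
    SameClass cs a b = ℓ a ≡ ℓ b × ℓ a ∈ cs × ℓ a ≢ t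

    class : Fin m → List (Fin n) → List (Fin n)
    class c = filter (λ v → ℓ v ≟ c)

    cover-classes : ∀ cs U → (∀ c → c ≢ t → length (class c U) < bound) → Cover r U (SameClass cs)
    cover-classes [] U small = record { pairs = [] ; size = z≤n ; covers = λ { _ _ (_ , () , _) } }
    cover-classes (c ∷ cs) U small with c ≟ t
    -- `small` says nothing about the class labelled `t` and `SameClass` asks nothing of it, so this
    -- class is not split off.
    ... | yes c≡t = record
      { pairs = pairs ; size = size
      ; covers = λ where
          a∈U b∈U (_ , here ℓa≡c , ℓa≢t) ne      → contradiction (trans ℓa≡c c≡t) ℓa≢t
          a∈U b∈U (eq , there ℓa∈cs , ℓa≢t) ne → covers a∈U b∈U (eq , ℓa∈cs , ℓa≢t) ne
      }
      where open Cover (cover-classes cs U small)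
    ... | no  c≢t = cover-split (λ v → ℓ v ≟ c) split (solve (class c U) (small c c≢t))
      -- Removing one class only shrinks the others, so they stay below `bound`.
      (cover-classes cs rest λ c′ c′≢t → ≤-<-trans
        (length-mono-≤ (filter⁺ (λ v → ℓ v ≟ c′) (λ v → ℓ v ≟ c′) (λ { refl → id }) (filter-⊆ _ U))) (small c′ c′≢t))
      where
      rest = filter (λ v → ¬? (ℓ v ≟ c)) U
      split : ∀ {a b} → SameClass (c ∷ cs) a b →
        (ℓ a ≡ c × ℓ b ≡ c) ⊎ (ℓ a ≢ c × ℓ b ≢ c × SameClass cs a b)
      split {a} (eq , ℓa∈ , ℓa≢t) with ℓ a ≟ c | ℓa∈
      ... | yes ℓa≡c | _            = inj₁ (ℓa≡c , trans (sym eq) ℓa≡c)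
      ... | no  ℓa≢c | here ℓa≡c    = contradiction ℓa≡c ℓa≢c
      ... | no  ℓa≢c | there ℓa∈cs = inj₂ (ℓa≢c , ℓa≢c ∘ trans eq , eq , ℓa∈cs , ℓa≢t)

  -- Bags as separators, and the recursion.

  module _ (D : TreeDecomposition G) where
    open TreeDecomposition D
    open Tree tree isTree

    -- Any node whose bag contains `v` would do: for `v` outside `bag t`, `coherent-avoiding` puts
    -- all of them in one branch at `t`.
    home : Fin n → Fin nodes
    home v = coversVertices v .proj₁

    ∈home : ∀ v → v ∈ₛ bag (home v)
    ∈home v = coversVertices v .proj₂

    ∉bag⇒home≢ : ∀ {t v} → v ∉ₛ bag t → home v ≢ t
    ∉bag⇒home≢ {v = v} v∉ refl = v∉ (∈home v)

    MeetsBag : Fin nodes → ℕ → Rel (Fin n) 0ℓ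
    MeetsBag t k a b = ∃ λ x → x ∈ₛ bag t × ∃₂ λ i j → Walk _~_ i a x × Walk _~_ j x b × i + j ≡ k

    -- The nodes whose bags contain `v` form a connected part of the tree, and `t` is not among
    -- them.
    coherent-avoiding : ∀ {t v s s′} → v ∉ₛ bag t → v ∈ₛ bag s → v ∈ₛ bag s′ → Star (Avoid tree t) s s′
    coherent-avoiding {t} {v} v∉ v∈s v∈s′ = go (coherent v v∈s v∈s′ .proj₂)
      where
      go : ∀ {k s s′} → Walk (TreeEdgeAt v) k s s′ → Star (Avoid tree t) s s′
      go [] = ε
      go ((r , v∈s , v∈w) ∷ p) = (r , (λ { refl → v∉ v∈s }) , (λ { refl → v∉ v∈w })) ◅ go p

    -- This is the separator property of bags: while a walk stays off `bag t`, the homes of its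
    -- vertices stay in one component of the tree without `t`.
    meets-or-avoids : ∀ t {k a b} → Walk _~_ k a b →
      MeetsBag t k a b ⊎ (a ∉ₛ bag t × b ∉ₛ bag t × Star (Avoid tree t) (home a) (home b))
    meets-or-avoids t {a = a} p with a ∈? bag t
    meets-or-avoids t {k} {a = a} p | yes a∈ = inj₁ (a , a∈ , 0 , k , [] , p , refl)
    meets-or-avoids t [] | no a∉ = inj₂ (a∉ , a∉ , ε)
    meets-or-avoids t (r ∷ p) | no a∉ with meets-or-avoids t p
    ... | inj₁ (x , x∈ , i , j , q , q′ , eq) = inj₁ (x , x∈ , suc i , j , r ∷ q , q′ , cong suc eq)
    ... | inj₂ (w∉ , b∉ , q) =
      -- A bag containing both ends of the edge links their homes without passing `t`.
      let s , a∈s , w∈s = coversEdges r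
      in inj₂ (a∉ , b∉ , coherent-avoiding a∉ (∈home _) a∈s ◅◅ coherent-avoiding w∉ w∈s (∈home _) ◅◅ q)

    meets-or-same : ∀ t {k a b} → Walk _~_ k a b →
      MeetsBag t k a b ⊎ (dir t (home a) ≡ dir t (home b) × dir t (home a) ≢ t)
    meets-or-same t p with meets-or-avoids t p
    ... | inj₁ meets = inj₁ meets
    ... | inj₂ (a∉ , b∉ , q) =
      inj₂ (dir-cong (∉bag⇒home≢ a∉) (∉bag⇒home≢ b∉) q ,
            λ eq → Graph.~-irr tree eq (dir~ (∉bag⇒home≢ a∉)))

    module _ {w : ℕ} (bag≤ : ∀ t → ∣ bag t ∣ ≤ w) where

      -- One level spends at most `K` pairs per vertex on its queries; the parts, being disjoint,
      -- share the budget `k * K` of the remaining levels. At `k = 0` the list is empty.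
      cover : ∀ k U → length U < 2 ^ k → Cover (k * (w * suc (maxDegree G))) U Everything
      cover zero    [] _ = record { pairs = [] ; size = z≤n ; covers = λ () }
      cover zero    (_ ∷ _) (s≤s ())
      cover (suc k) U U< = record
        { pairs  = queries G (bag t) U ++ C.pairs
        ; size   = begin
            length (queries G (bag t) U ++ C.pairs)          ≡⟨ length-++ (queries G (bag t) U) ⟩
            length (queries G (bag t) U) + length C.pairs    ≤⟨ +-mono-≤ (length-queries G (bag t) U) C.size ⟩
            (∣ bag t ∣ * suc (maxDegree G)) * length U + (k * K) * length U
              ≤⟨ +-monoˡ-≤ _ (*-monoˡ-≤ (length U) (*-monoˡ-≤ (suc (maxDegree G)) (bag≤ t))) ⟩
            K * length U + (k * K) * length U                ≡⟨ *-distribʳ-+ (length U) K (k * K) ⟨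
            (K + k * K) * length U                           ∎
        ; covers = covers
        }
        where
        open ≤-Reasoning
        K = w * suc (maxDegree G)
        t = centroid home U .proj₁
        module C = Cover (cover-classes (cover k) (dir t ∘ home) t (allFin nodes) U
          -- A branch holds at most half of `U`, so `U<` halves to the bound `2 ^ k` that `cover k`
          -- asks for.
          λ c c≢t → *-cancelˡ-< 2 _ _ (≤-<-trans (centroid home U .proj₂ c c≢t) U<))
        covers : ∀ {a b} → a ∈ U → b ∈ U → ⊤ → NonEdge G connected a b →
          CoveredBy (queries G (bag t) U ++ C.pairs) a b
        covers {a} {b} a∈U b∈U _ ne = Sum.[
            (λ (x , x∈ , i , j , p , q , eq) → coveredBy-++ˡ (between-covered a∈U b∈U ne x∈ p q eq))
          , (λ (eq , ≢t) →
              coveredBy-++ʳ (queries G (bag t) U) (C.covers a∈U b∈U (eq , ∈-allFin _ , ≢t) ne))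
          ]′ (meets-or-same t (d-walk a b))

  -- From lists of queries to `OPT`.

  OPT≤ : ∀ L → (∀ {a b} → NonEdge G connected a b → CoveredBy L a b) → OPT G connected ≤ length L
  OPT≤ L covered = ≤-trans
    (minimumCover G connected .proj₂ .proj₂ _ (T , T-covers , refl))
    (≤-trans (∣fromList∣≤length codes) (≤-reflexive (length-map code L)))
    where
    code : Fin n × Fin n → Fin (n * n)
    code (u , v) = combine u v
    codes = map code L
    -- Repeated pairs are harmless: they only make `T` smaller than `L` is long.
    T = fromList codes
    T-covers : Covers G connected T
    T-covers a b = mk⇔ (λ (_ , _ , _ , ne , _) → ne)
      λ ne → let u , v , uv∈L , s = covered ne in u , v , ∈-fromList (∈-map⁺ code uv∈L) , s

  OPT≤log : (D : TreeDecomposition G) →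
    OPT G connected ≤ (suc ⌊log₂ n ⌋ * (suc (TreeDecomposition.width D) * suc (maxDegree G))) * n
  OPT≤log D = ≤-trans
    (OPT≤ C.pairs λ ne → C.covers (∈-allFin _) (∈-allFin _) tt ne)
    (≤-trans C.size (≤-reflexive (cong ((suc ⌊log₂ n ⌋ * (suc width * suc (maxDegree G))) *_) (length-tabulate {n = n} id))))
    where
    open TreeDecomposition D
    bag≤ : ∀ t → ∣ bag t ∣ ≤ suc width
    -- `width` subtracts with truncation, but the maximal bag size is at most `suc width` even when
    -- it is 0.
    bag≤ t = ≤-trans (≤-maximum (λ t → ∣ bag t ∣) t) (m≤n+m∸n _ 1)
    module C = Cover (cover D bag≤ (suc ⌊log₂ n ⌋) (allFin n)
      (≤-trans (s≤s (≤-reflexive (length-tabulate {n = n} id))) (n<2^[1+⌊log₂n⌋] n)))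

-- Absorbing the additive constants.

first-step : ∀ {n k u v} {R : Rel (Fin n) 0ℓ} → u ≢ v → Walk R k u v → ∃ (R u)
first-step u≢u []      = contradiction refl u≢u
first-step _   (r ∷ _) = _ , r

-- Some bag contains both ends of the edge. A positive width lets `suc width` be absorbed into a
-- multiple of `width`.
1≤width : ∀ {n} {G : Graph n} (D : TreeDecomposition G) {u v} → Graph._~_ G u v → 1 ≤ TreeDecomposition.width D
1≤width {G = G} D {u} {v} r with TreeDecomposition.coversEdges D r
... | t , u∈ , v∈ = ∸-monoˡ-≤ 1 (≤-trans two (≤-maximum (λ t → ∣ bag t ∣) t))
  where
  open TreeDecomposition D
  two : 2 ≤ ∣ bag t ∣
  two = subst (2 ≤_) (length-elements (bag t))
    (two-members (∈-elements u∈) (∈-elements v∈) λ u≡v → Graph.~-irr G u≡v r)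
    where
    two-members : ∀ {A : Set} {x y : A} {xs} → x ∈ xs → y ∈ xs → x ≢ y → 2 ≤ length xs
    two-members (here refl) (here refl) x≢y = contradiction refl x≢y
    two-members {xs = _ ∷ _ ∷ _} _ _ _      = s≤s (s≤s z≤n)
    two-members {xs = _ ∷ []} (there ()) _ _
    two-members {xs = _ ∷ []} _ (there ()) _

1≤maxDegree : ∀ {n} (G : Graph n) {u v} → Graph._~_ G u v → 1 ≤ maxDegree G
1≤maxDegree G {u} r = ≤-trans
  (subst (1 ≤_) (length-elements (Vec.tabulate (λ w → does (Graph._~?_ G u w)))) (nonempty (∈-neighbours G r)))
  (≤-maximum (degree G) u)
  where
  nonempty : ∀ {A : Set} {x : A} {xs} → x ∈ xs → 1 ≤ length xs
  nonempty {xs = _ ∷ _} _ = s≤s z≤n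

-- Each of the three successors is at most a doubling, whence the `8`. Then the factor `w` is
-- enlarged to `Δ + w * l`, which gives away a logarithm.
arithmetic : ∀ l w Δ n → 1 ≤ l → 1 ≤ w → 1 ≤ Δ →
  (suc l * (suc w * suc Δ)) * n ≤ 8 * (Δ * (Δ + w * l) * n * l)
arithmetic l w Δ n 1≤l 1≤w 1≤Δ = begin
  (suc l * (suc w * suc Δ)) * n
    ≤⟨ *-monoˡ-≤ n (*-mono-≤ (double 1≤l) (*-mono-≤ (double 1≤w) (double 1≤Δ))) ⟩
  ((l + l) * ((w + w) * (Δ + Δ))) * n   ≡⟨ lemma l w Δ n ⟩
  8 * (Δ * (w * 1) * n * l)
    ≤⟨ *-monoʳ-≤ 8 (*-monoˡ-≤ l (*-monoˡ-≤ n (*-monoʳ-≤ Δ (≤-trans (*-monoʳ-≤ w 1≤l) (m≤n+m _ Δ))))) ⟩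
  8 * (Δ * (Δ + w * l) * n * l)         ∎
  where
  open ≤-Reasoning
  double : ∀ {x} → 1 ≤ x → suc x ≤ x + x
  double {x} 1≤x = +-monoˡ-≤ x 1≤x
  lemma : ∀ l w Δ n → ((l + l) * ((w + w) * (Δ + Δ))) * n ≡ 8 * (Δ * (w * 1) * n * l)
  lemma = solve-∀

OPT≤-distinct : ∀ {n} (G : Graph n) (connected : Connected G) (D : TreeDecomposition G) →
  {u v : Fin n} → u ≢ v → 1 ≤ ⌊log₂ n ⌋ → let w = TreeDecomposition.width D in
  OPT G connected ≤ 8 * (maxDegree G * (maxDegree G + w * ⌊log₂ n ⌋) * n * ⌊log₂ n ⌋)
OPT≤-distinct {n} G connected D {u} {v} u≢v 1≤log =
  let _ , r = first-step u≢v (connected .proj₂ u v .proj₂)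
  in ≤-trans (OPT≤log G connected D)
       (arithmetic ⌊log₂ n ⌋ (TreeDecomposition.width D) (maxDegree G) n
         1≤log (1≤width D r) (1≤maxDegree G r))

OPT≤0 : ∀ {n} (G : Graph n) (connected : Connected G) → (∀ (u v : Fin n) → u ≡ v) → OPT G connected ≤ 0
OPT≤0 G connected trivial = OPT≤ G connected [] λ (a≢b , _) → contradiction (trivial _ _) a≢b

theorem7 : ∃[ C ] (∀ {n} (G : Graph n) (connected : Connected G) (tw : ℕ) →
    IsTreewidth G tw →
    OPT G connected ≤
    C * (maxDegree G * (maxDegree G + tw * ⌊log₂ n ⌋) * n * ⌊log₂ n ⌋))
theorem7 = 8 , bound
  where
  bound : ∀ {n} (G : Graph n) (connected : Connected G) (tw : ℕ) → IsTreewidth G tw →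
    OPT G connected ≤ 8 * (maxDegree G * (maxDegree G + tw * ⌊log₂ n ⌋) * n * ⌊log₂ n ⌋)
  bound {zero} G (() , _)
  -- Here the logarithm is 0 and the right side vanishes, so `OPT` itself must be 0; a single vertex
  -- has no non-edges.
  bound {suc zero} G connected tw _ =
    ≤-trans (OPT≤0 G connected λ { zero zero → refl }) z≤n
  bound {suc (suc n)} G connected _ ((D , refl) , _) =
    -- `⌊log₂ 2⌋` evaluates to 1, so monotonicity makes the logarithm positive.
    OPT≤-distinct G connected D {zero} {suc zero} (λ ()) (⌊log₂⌋-mono-≤ {2} {2 + n} (s≤s (s≤s z≤n)))
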